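{- For every connected graph $G$ with no isolated vertices, $$\gamma_t(G) \le \left\lceil \frac{2(\gamma(G)+\gamma_c(G))}{3}\right\rceil.$$ Moreover, this bound is tight.
   Context: All graphs are finite, simple and undirected. A set $S\subseteq V(G)$ is a dominating set if every vertex not in $S$ is adjacent to some vertex of $S$; $\gamma(G)$ is the minimum size of a dominating set. A set $S$ is a total dominating set if every vertex of $G$ (including those in $S$) is adjacent to some vertex of $S$; $\gamma_t(G)$ is the minimum size of a total dominating set. A set $S$ is a connected dominating set if it is dominating and the subgraph induced by $S$ is connected; $\gamma_c(G)$ is the minimum size of a connected dominating set. -}

module Defs where

open import Data.Fin.Base using (Fin)
open import Data.Fin.Properties using (_≟_; all?; any?)
open import Data.Fin.Subset using (Subset; _∈_; _∉_; ⊤; ∣_∣; Nonempty)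
open import Data.Fin.Subset.Properties using (_∈?_; ∈⊤; nonempty?; anySubset?)
open import Data.List.Base using (List; []; _∷_; allFin)
open import Data.List.Membership.Propositional using () renaming (_∈_ to _∈ˡ_)
open import Data.List.Membership.Propositional.Properties using (∈-allFin)
open import Data.List.Relation.Unary.Any using (here; there)
open import Data.Nat.Base using (ℕ; _≤_; _<_)
open import Data.Nat.Induction using (Acc; acc; <-wellFounded)
open import Data.Nat.Properties using (_<?_; ≮⇒≥)
open import Data.Product.Base using (∃; _×_; _,_; proj₁; proj₂)
open import Data.Sum.Base using (_⊎_; inj₁; inj₂)
open import Level using (0ℓ)
open import Relation.Binary.Construct.Closure.ReflexiveTransitive using (Star; ε; _◅_; _◅◅_; gmap)
open import Relation.Binary.Core using (Rel)
open import Relation.Binary.Definitions as Binary using (Symmetric; Irreflexive)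
open import Relation.Binary.PropositionalEquality using (_≡_; refl)
open import Relation.Nullary.Decidable.Core using (yes; no; map′; _×-dec_; _⊎-dec_; _→-dec_; ¬?)
open import Relation.Nullary.Negation.Core using (contradiction)
open import Relation.Unary using (Pred; Decidable)

-- Finite simple undirected graphs, with vertex set Fin order.
-- Finiteness includes decidability of adjacency.
record Graph : Set₁ where
  field
    order  : ℕ
    Adj    : Rel (Fin order) 0ℓ
    sym    : Symmetric Adj
    irrefl : Irreflexive _≡_ Adj
    adj?   : Binary.Decidable Adj

  Vertex : Set
  Vertex = Fin order

  VertexSet : Set
  VertexSet = Subset order

open Graph using (Vertex; VertexSet)

module _ (G : Graph) where
  open Graph G using (Adj)

  -- The graph with no vertices does not count as connected.
  Connected : Set
  Connected = Vertex G × (∀ u v → Star Adj u v)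

  NoIsolatedVertices : Set
  NoIsolatedVertices = ∀ v → ∃ λ u → Adj v u

  Dominating : Pred (VertexSet G) 0ℓ
  Dominating S = ∀ v → v ∉ S → ∃ λ u → u ∈ S × Adj v u

  TotalDominating : Pred (VertexSet G) 0ℓ
  TotalDominating S = ∀ v → ∃ λ u → u ∈ S × Adj v u

  AdjWithin : VertexSet G → Rel (Vertex G) 0ℓ
  AdjWithin S u v = u ∈ S × v ∈ S × Adj u v

  InducesConnected : Pred (VertexSet G) 0ℓ
  InducesConnected S =
    Nonempty S × (∀ u v → u ∈ S → v ∈ S → Star (AdjWithin S) u v)

  ConnectedDominating : Pred (VertexSet G) 0ℓ
  ConnectedDominating S = Dominating S × InducesConnected S

-- Reachability is decidable by Warshall's algorithm: Via R xs relates u to v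
-- when v is reachable from u through intermediate vertices from xs only.
module _ {n} {R : Rel (Fin n) 0ℓ} (R? : Binary.Decidable R) where

  private
    Via : List (Fin n) → Rel (Fin n) 0ℓ
    Via []       u v = u ≡ v ⊎ R u v
    Via (x ∷ xs) u v = Via xs u v ⊎ (Via xs u x × Via xs x v)

    via? : ∀ xs → Binary.Decidable (Via xs)
    via? []       u v = (u ≟ v) ⊎-dec R? u v
    via? (x ∷ xs) u v = via? xs u v ⊎-dec (via? xs u x ×-dec via? xs x v)

    via⇒star : ∀ xs {u v} → Via xs u v → Star R u v
    via⇒star []       (inj₁ refl)    = ε
    via⇒star []       (inj₂ r)       = r ◅ ε
    via⇒star (x ∷ xs) (inj₁ p)       = via⇒star xs p
    via⇒star (x ∷ xs) (inj₂ (p , q)) = via⇒star xs p ◅◅ via⇒star xs q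

    base : ∀ xs {u v} → u ≡ v ⊎ R u v → Via xs u v
    base []       p = p
    base (x ∷ xs) p = inj₁ (base xs p)

    toHead : ∀ {x xs u} → Via (x ∷ xs) u x → Via xs u x
    toHead (inj₁ p)       = p
    toHead (inj₂ (p , _)) = p

    fromHead : ∀ {x xs v} → Via (x ∷ xs) x v → Via xs x v
    fromHead (inj₁ p)       = p
    fromHead (inj₂ (_ , p)) = p

    join : ∀ xs {u y v} → y ∈ˡ xs → Via xs u y → Via xs y v → Via xs u v
    join (x ∷ xs) (here refl) p q = inj₂ (toHead {xs = xs} p , fromHead {xs = xs} q)
    join (x ∷ xs) (there y∈) (inj₁ p)        (inj₁ q)        = inj₁ (join xs y∈ p q)
    join (x ∷ xs) (there y∈) (inj₁ p)        (inj₂ (q , q′)) = inj₂ (join xs y∈ p q , q′)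
    join (x ∷ xs) (there y∈) (inj₂ (p , p′)) (inj₁ q)        = inj₂ (p , join xs y∈ p′ q)
    join (x ∷ xs) (there y∈) (inj₂ (p , _))  (inj₂ (_ , q′)) = inj₂ (p , q′)

    star⇒via : ∀ {u v} → Star R u v → Via (allFin n) u v
    star⇒via ε       = base (allFin n) (inj₁ refl)
    star⇒via (r ◅ p) =
      join (allFin n) (∈-allFin _) (base (allFin n) (inj₂ r)) (star⇒via p)

  star? : Binary.Decidable (Star R)
  star? u v = map′ (via⇒star (allFin n)) star⇒via (via? (allFin n) u v)

module _ (G : Graph) where
  open Graph G using (adj?)

  dominating? : Decidable (Dominating G)
  dominating? S =
    all? λ v → ¬? (v ∈? S) →-dec any? λ u → (u ∈? S) ×-dec adj? v u

  totalDominating? : Decidable (TotalDominating G)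
  totalDominating? S = all? λ v → any? λ u → (u ∈? S) ×-dec adj? v u

  inducesConnected? : Decidable (InducesConnected G)
  inducesConnected? S =
    nonempty? S ×-dec
    all? λ u → all? λ v → (u ∈? S) →-dec ((v ∈? S) →-dec
      star? (λ a b → (a ∈? S) ×-dec ((b ∈? S) ×-dec adj? a b)) u v)

  connectedDominating? : Decidable (ConnectedDominating G)
  connectedDominating? S = dominating? S ×-dec inducesConnected? S

  ⊤-dominating : Dominating G ⊤
  ⊤-dominating v v∉⊤ = contradiction ∈⊤ v∉⊤

  ⊤-totalDominating : NoIsolatedVertices G → TotalDominating G ⊤
  ⊤-totalDominating noIso v = let u , vu = noIso v in u , ∈⊤ , vu

  ⊤-connectedDominating : Connected G → ConnectedDominating G ⊤
  ⊤-connectedDominating (v₀ , walk) =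
    ⊤-dominating , (v₀ , ∈⊤) , λ u v _ _ →
      gmap (λ w → w) (λ ab → ∈⊤ , ∈⊤ , ab) (walk u v)

IsMinimumSize : ∀ {n} → Pred (Subset n) 0ℓ → ℕ → Set
IsMinimumSize P k = (∃ λ S → P S × ∣ S ∣ ≡ k) × (∀ S → P S → k ≤ ∣ S ∣)

minimumSize : ∀ {n} {P : Pred (Subset n) 0ℓ} →
              Decidable P → ∃ P → ∃ (IsMinimumSize P)
minimumSize {n} {P} P? (S₀ , p₀) = descend S₀ p₀ (<-wellFounded ∣ S₀ ∣)
  where
  descend : ∀ S → P S → Acc _<_ ∣ S ∣ → ∃ (IsMinimumSize P)
  descend S p (acc rec) with anySubset? (λ T → P? T ×-dec (∣ T ∣ <? ∣ S ∣))
  ... | yes (T , q , T<S) = descend T q (rec T<S)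
  ... | no  noSmaller     =
    ∣ S ∣ , (S , p , refl) , λ T q → ≮⇒≥ λ T<S → noSmaller (T , q , T<S)

-- A total (connected) dominating set need not exist in an arbitrary graph, so
-- γₜ and γ꜀ take the hypothesis which makes V(G) itself such a set.
module _ (G : Graph) where

  γ : ℕ
  γ = proj₁ (minimumSize (dominating? G) (⊤ , ⊤-dominating G))

  γ-isMinimum : IsMinimumSize (Dominating G) γ
  γ-isMinimum = proj₂ (minimumSize (dominating? G) (⊤ , ⊤-dominating G))

  γₜ : NoIsolatedVertices G → ℕ
  γₜ noIso =
    proj₁ (minimumSize (totalDominating? G) (⊤ , ⊤-totalDominating G noIso))

  γₜ-isMinimum : ∀ noIso → IsMinimumSize (TotalDominating G) (γₜ noIso)
  γₜ-isMinimum noIso =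
    proj₂ (minimumSize (totalDominating? G) (⊤ , ⊤-totalDominating G noIso))

  γ꜀ : Connected G → ℕ
  γ꜀ conn =
    proj₁ (minimumSize (connectedDominating? G) (⊤ , ⊤-connectedDominating G conn))

  γ꜀-isMinimum : ∀ conn → IsMinimumSize (ConnectedDominating G) (γ꜀ conn)
  γ꜀-isMinimum conn =
    proj₂ (minimumSize (connectedDominating? G) (⊤ , ⊤-connectedDominating G conn))

{-# OPTIONS --safe #-}

-- Adding a neighbour of each vertex of a dominating set gives γₜ ≤ 2γ, and
-- adding a single neighbour of one vertex to a connected dominating set gives
-- γₜ ≤ 1 + γ꜀.  Hence 3γₜ ≤ 2(γ + γ꜀) + 2, which is the bound with the ceiling.
-- It is attained by the complete graph K_k with a path bᵢ cᵢ hung from each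
-- vertex aᵢ: the set of all bᵢ gives γ ≤ k, the set of all aᵢ and bᵢ gives
-- γ꜀ ≤ 2k, and every total dominating set contains bᵢ (the only neighbour of cᵢ)
-- and one of aᵢ, cᵢ (the neighbours of bᵢ) for each i, so γₜ ≥ 2k.
module Submission where

open import Defs
open import Data.Empty using (⊥)
open import Data.Fin.Base using (Fin; zero; suc; combine; remQuot)
open import Data.Fin.Patterns using (0F; 1F; 2F)
open import Data.Fin.Properties using (_≟_; combine-remQuot; remQuot-combine)
open import Data.Fin.Subset using (Subset; inside; outside; _∈_; ⊤; _∪_; ⁅_⁆; ∣_∣) renaming (⊥ to ∅)
open import Data.Fin.Subset.Properties using (_∈?_; ∈⊤; ∣⊤∣≡n; ∣⊥∣≡0; ∣⁅x⁆∣≡1; x∈⁅x⁆; p⊆p∪q; q⊆p∪q; p⊆q⇒∣p∣≤∣q∣)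
open import Data.Integer.Base as ℤ using (+_; _≤_; +≤+)
open import Data.Integer.DivMod using ([n/d]*d≤n; n<s[n/ℕd]*d; div-pos-is-/ℕ)
import Data.Integer.Properties as ℤ
open import Data.Nat.Base as ℕ using (ℕ; suc; z≤n; s≤s)
import Data.Nat.Properties as ℕ
open import Data.Nat.Tactic.RingSolver using (solve-∀)
open import Data.Product.Base using (Σ; ∃; _×_; _,_; proj₁; proj₂; uncurry)
open import Data.Rational.Unnormalised.Base using (_/_; ceiling)
open import Data.Vec.Base using ([]; _∷_; there)
open import Function.Base using (_∘_; id)
open import Relation.Binary.Construct.Closure.ReflexiveTransitive using (Star; ε; _◅_; _◅◅_; gmap; reverse)
open import Relation.Binary.Core using (Rel)
open import Relation.Binary.Definitions using (Decidable; Symmetric; Irreflexive)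
open import Relation.Binary.PropositionalEquality using (_≡_; _≢_; refl; sym; trans; cong; subst; subst₂; ≢-sym)
open import Relation.Nullary.Decidable.Core using (yes; no; ¬?)
open import Relation.Nullary.Negation.Core using (contradiction)
open import Level using (0ℓ)

open Graph using (Adj)

-- Ceilings

-- The ceiling `c` unfolds to `- q`, where `q` is the floor of `- n / d`. From `q * d ≤ - n` follows
-- `n ≤ c * d`, hence `m * d < (1 + c) * d`, and `d` cancels.
≤-ceiling : ∀ {m n} d .{{_ : ℕ.NonZero d}} →
            m ℕ.* d ℕ.< n ℕ.+ d → + m ≤ ceiling (+ n / d)
≤-ceiling {m} {n} d@(suc _) md<n+d =
  subst (+ m ≤_) (ℤ.pred-suc c) (ℤ.i<j⇒i≤pred[j] m<1+c)
  where
  c = ceiling (+ n / d)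
  q = (ℤ.- + n) ℤ./ + d

  n≤cd : + n ≤ c ℤ.* + d
  n≤cd = begin
    + n                ≡⟨ ℤ.neg-involutive (+ n) ⟨
    ℤ.- (ℤ.- + n)      ≤⟨ ℤ.neg-mono-≤ ([n/d]*d≤n (ℤ.- + n) (+ d)) ⟩
    ℤ.- (q ℤ.* + d)    ≡⟨ ℤ.neg-distribˡ-* q (+ d) ⟩
    c ℤ.* + d          ∎
    where open ℤ.≤-Reasoning

  m<1+c : + m ℤ.< ℤ.suc c
  m<1+c = ℤ.*-cancelʳ-<-nonNeg (+ d) (begin-strict
    + m ℤ.* + d        ≡⟨ ℤ.pos-* m d ⟨
    + (m ℕ.* d)        <⟨ ℤ.+<+ md<n+d ⟩
    + n ℤ.+ + d        ≡⟨ ℤ.+-comm (+ n) (+ d) ⟩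
    + d ℤ.+ + n        ≤⟨ ℤ.+-monoʳ-≤ (+ d) n≤cd ⟩
    + d ℤ.+ c ℤ.* + d  ≡⟨ ℤ.suc-* c (+ d) ⟨
    ℤ.suc c ℤ.* + d    ∎)
    where open ℤ.≤-Reasoning

ceiling-≤ : ∀ {m n} d .{{_ : ℕ.NonZero d}} →
            n ℕ.≤ m ℕ.* d → ceiling (+ n / d) ≤ + m
ceiling-≤ {m} {n} d@(suc _) n≤md = ℤ.≮⇒≥ λ m<c →
  ℤ.<⇒≱ (n<s[n/ℕd]*d (ℤ.- + n) d) (begin
    ℤ.suc (ℤ.- + n ℤ./ℕ d) ℤ.* + d
      ≤⟨ ℤ.*-monoʳ-≤-nonNeg (+ d) (ℤ.i<j⇒suc[i]≤j (q<-m m<c)) ⟩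
    ℤ.- + m ℤ.* + d    ≡⟨ ℤ.neg-distribˡ-* (+ m) (+ d) ⟨
    ℤ.- (+ m ℤ.* + d)  ≡⟨ cong ℤ.-_ (ℤ.pos-* m d) ⟨
    ℤ.- + (m ℕ.* d)    ≤⟨ ℤ.neg-mono-≤ (+≤+ n≤md) ⟩
    ℤ.- + n            ∎)
  where
  open ℤ.≤-Reasoning
  q = (ℤ.- + n) ℤ./ + d

  q<-m : + m ℤ.< ℤ.- q → (ℤ.- + n) ℤ./ℕ d ℤ.< ℤ.- + m
  q<-m m<-q = subst (ℤ._< ℤ.- + m)
    -- `ceiling` divides by the integer `+ d`, while the remainder bound above concerns `/ℕ`; the
    -- two quotients agree.
    (trans (ℤ.neg-involutive q) (div-pos-is-/ℕ (ℤ.- + n) d)) (ℤ.neg-mono-< m<-q)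

-- Cardinalities of unions and images

∣p∪q∣≤∣p∣+∣q∣ : ∀ {n} (p q : Subset n) → ∣ p ∪ q ∣ ℕ.≤ ∣ p ∣ ℕ.+ ∣ q ∣
∣p∪q∣≤∣p∣+∣q∣ []            []            = z≤n
∣p∪q∣≤∣p∣+∣q∣ (outside ∷ p) (outside ∷ q) = ∣p∪q∣≤∣p∣+∣q∣ p q
∣p∪q∣≤∣p∣+∣q∣ (outside ∷ p) (inside ∷ q)  =
  subst (suc ∣ p ∪ q ∣ ℕ.≤_) (sym (ℕ.+-suc ∣ p ∣ ∣ q ∣)) (s≤s (∣p∪q∣≤∣p∣+∣q∣ p q))
∣p∪q∣≤∣p∣+∣q∣ (inside ∷ p)  (outside ∷ q) = s≤s (∣p∪q∣≤∣p∣+∣q∣ p q)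
∣p∪q∣≤∣p∣+∣q∣ (inside ∷ p)  (inside ∷ q)  =
  s≤s (ℕ.≤-trans (∣p∪q∣≤∣p∣+∣q∣ p q) (ℕ.+-monoʳ-≤ ∣ p ∣ (ℕ.n≤1+n ∣ q ∣)))

∣⁅x⁆∪p∣≤1+∣p∣ : ∀ {n} (x : Fin n) p → ∣ ⁅ x ⁆ ∪ p ∣ ℕ.≤ suc ∣ p ∣
∣⁅x⁆∪p∣≤1+∣p∣ x p =
  subst (λ m → ∣ ⁅ x ⁆ ∪ p ∣ ℕ.≤ m ℕ.+ ∣ p ∣) (∣⁅x⁆∣≡1 x) (∣p∪q∣≤∣p∣+∣q∣ ⁅ x ⁆ p)

-- Serves three times: for chosen neighbours of a dominating set, for the sets of all `a i` or all
-- `b i`, and for the projection `π` in the lower bound.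
image : ∀ {m n} → (Fin m → Fin n) → Subset m → Subset n
image f []            = ∅
image f (inside ∷ p)  = ⁅ f zero ⁆ ∪ image (f ∘ suc) p
image f (outside ∷ p) = image (f ∘ suc) p

∈-image : ∀ {m n} (f : Fin m → Fin n) {p x} → x ∈ p → f x ∈ image f p
∈-image f {inside ∷ p}  {zero}  _           = p⊆p∪q _ (x∈⁅x⁆ (f zero))
∈-image f {inside ∷ p}  {suc x} (there x∈p) = q⊆p∪q ⁅ f zero ⁆ _ (∈-image (f ∘ suc) x∈p)
∈-image f {outside ∷ p} {suc x} (there x∈p) = ∈-image (f ∘ suc) x∈p

∣image∣≤ : ∀ {m n} (f : Fin m → Fin n) p → ∣ image f p ∣ ℕ.≤ ∣ p ∣
∣image∣≤ {n = n} f []  = ℕ.≤-reflexive (∣⊥∣≡0 n)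
∣image∣≤ f (inside ∷ p)  =
  ℕ.≤-trans (∣⁅x⁆∪p∣≤1+∣p∣ (f zero) _) (s≤s (∣image∣≤ (f ∘ suc) p))
∣image∣≤ f (outside ∷ p) = ∣image∣≤ (f ∘ suc) p

-- The upper bound

module _ (G : Graph) (noIso : NoIsolatedVertices G) where

  γₜ≤2*∣dominating∣ : ∀ S → Dominating G S → γₜ G noIso ℕ.≤ 2 ℕ.* ∣ S ∣
  γₜ≤2*∣dominating∣ S dom = begin
    γₜ G noIso         ≤⟨ proj₂ (γₜ-isMinimum G noIso) (S ∪ N) total ⟩
    ∣ S ∪ N ∣          ≤⟨ ∣p∪q∣≤∣p∣+∣q∣ S N ⟩
    ∣ S ∣ ℕ.+ ∣ N ∣    ≤⟨ ℕ.+-monoʳ-≤ ∣ S ∣ (∣image∣≤ (proj₁ ∘ noIso) S) ⟩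
    ∣ S ∣ ℕ.+ ∣ S ∣    ≡⟨ cong (∣ S ∣ ℕ.+_) (ℕ.+-identityʳ ∣ S ∣) ⟨
    2 ℕ.* ∣ S ∣        ∎
    where
    open ℕ.≤-Reasoning
    N = image (proj₁ ∘ noIso) S

    total : TotalDominating G (S ∪ N)
    total v with v ∈? S
    ... | yes v∈S = let u , vu = noIso v in
                    u , q⊆p∪q S N (∈-image (proj₁ ∘ noIso) v∈S) , vu
    ... | no  v∉S = let u , u∈S , vu = dom v v∉S in u , p⊆p∪q N u∈S , vu

  γₜ≤1+∣connectedDominating∣ : ∀ S → ConnectedDominating G S → γₜ G noIso ℕ.≤ suc ∣ S ∣
  γₜ≤1+∣connectedDominating∣ S (dom , (s , s∈S) , walk) = ℕ.≤-trans
    (proj₂ (γₜ-isMinimum G noIso) (⁅ s′ ⁆ ∪ S) total) (∣⁅x⁆∪p∣≤1+∣p∣ s′ S)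
    where
    s′ = proj₁ (noIso s)

    total : TotalDominating G (⁅ s′ ⁆ ∪ S)
    total v with v ∈? S
    ... | no v∉S  = let u , u∈S , vu = dom v v∉S in u , q⊆p∪q ⁅ s′ ⁆ S u∈S , vu
    -- The first step of a walk from `v` to `s` inside `S` yields a neighbour in `S`. The empty walk
    -- forces `v` to be `s`, which is what `s′` was added for.
    ... | yes v∈S with walk v s v∈S s∈S
    ...   | ε                  = s′ , p⊆p∪q S (x∈⁅x⁆ s′) , proj₂ (noIso s)
    ...   | (_ , u∈S , vu) ◅ _ = _ , q⊆p∪q ⁅ s′ ⁆ S u∈S , vu

  γₜ≤2*γ : γₜ G noIso ℕ.≤ 2 ℕ.* γ G
  γₜ≤2*γ = let S , dom , ∣S∣≡γ = proj₁ (γ-isMinimum G) in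
    subst (λ n → γₜ G noIso ℕ.≤ 2 ℕ.* n) ∣S∣≡γ (γₜ≤2*∣dominating∣ S dom)

  γₜ≤1+γ꜀ : ∀ conn → γₜ G noIso ℕ.≤ suc (γ꜀ G conn)
  γₜ≤1+γ꜀ conn = let S , connDom , ∣S∣≡γ꜀ = proj₁ (γ꜀-isMinimum G conn) in
    subst (λ n → γₜ G noIso ℕ.≤ suc n) ∣S∣≡γ꜀ (γₜ≤1+∣connectedDominating∣ S connDom)

  γₜ≤⌈2[γ+γ꜀]/3⌉ : ∀ conn →
    + γₜ G noIso ≤ ceiling (+ (2 ℕ.* (γ G ℕ.+ γ꜀ G conn)) / 3)
  -- One of the three copies of `t` is bounded by `2γ`, the other two by `1 + γ꜀`. The surplus 2
  -- stays below the divisor 3, so the ceiling absorbs it.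
  γₜ≤⌈2[γ+γ꜀]/3⌉ conn = ≤-ceiling 3 (begin-strict
    t ℕ.* 3                        ≡⟨ split t ⟩
    t ℕ.+ 2 ℕ.* t                  ≤⟨ ℕ.+-mono-≤ γₜ≤2*γ (ℕ.*-monoʳ-≤ 2 (γₜ≤1+γ꜀ conn)) ⟩
    2 ℕ.* g ℕ.+ 2 ℕ.* (1 ℕ.+ c)    ≡⟨ collect g c ⟩
    2 ℕ.* (g ℕ.+ c) ℕ.+ 2          <⟨ ℕ.+-monoʳ-< (2 ℕ.* (g ℕ.+ c)) (ℕ.n<1+n 2) ⟩
    2 ℕ.* (g ℕ.+ c) ℕ.+ 3          ∎)
    where
    open ℕ.≤-Reasoning
    t = γₜ G noIso
    g = γ G
    c = γ꜀ G conn

    split : ∀ t → t ℕ.* 3 ≡ t ℕ.+ 2 ℕ.* t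
    split = solve-∀

    collect : ∀ g c → 2 ℕ.* g ℕ.+ 2 ℕ.* (1 ℕ.+ c) ≡ 2 ℕ.* (g ℕ.+ c) ℕ.+ 2
    collect = solve-∀

-- The extremal graphs

module Extremal (m : ℕ) where

  -- The successor keeps the clique nonempty, so that `a zero` exists, as connectedness demands.
  k : ℕ
  k = suc m

  -- (i , 0F), (i , 1F) and (i , 2F) are the vertices aᵢ, bᵢ and cᵢ.
  V : Set
  V = Fin k × Fin 3

  Link : Rel V 0ℓ
  Link (i , 0F) (j , 0F) = i ≢ j
  Link (i , 0F) (j , 1F) = i ≡ j
  Link (i , 1F) (j , 0F) = i ≡ j
  Link (i , 1F) (j , 2F) = i ≡ j
  Link (i , 2F) (j , 1F) = i ≡ j
  Link _        _        = ⊥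

  link-sym : Symmetric Link
  link-sym {i , 0F} {j , 0F} = ≢-sym
  link-sym {i , 0F} {j , 1F} = sym
  link-sym {i , 1F} {j , 0F} = sym
  link-sym {i , 1F} {j , 2F} = sym
  link-sym {i , 2F} {j , 1F} = sym

  link-irrefl : Irreflexive _≡_ Link
  link-irrefl {i , 0F} refl i≢i = i≢i refl
  link-irrefl {i , 1F} refl ()
  link-irrefl {i , 2F} refl ()

  link? : Decidable Link
  link? (i , 0F) (j , 0F) = ¬? (i ≟ j)
  link? (i , 0F) (j , 1F) = i ≟ j
  link? (i , 0F) (j , 2F) = no id
  link? (i , 1F) (j , 0F) = i ≟ j
  link? (i , 1F) (j , 1F) = no id
  link? (i , 1F) (j , 2F) = i ≟ j
  link? (i , 2F) (j , 0F) = no id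
  link? (i , 2F) (j , 1F) = i ≟ j
  link? (i , 2F) (j , 2F) = no id

  decode : Fin (k ℕ.* 3) → V
  decode = remQuot 3

  encode : V → Fin (k ℕ.* 3)
  encode = uncurry combine

  decode-encode : ∀ v → decode (encode v) ≡ v
  decode-encode (i , j) = remQuot-combine i j

  encode-decode : ∀ u → encode (decode u) ≡ u
  encode-decode = combine-remQuot {k} 3

  G : Graph
  G = record
    { order  = k ℕ.* 3
    ; Adj    = λ u v → Link (decode u) (decode v)
    ; sym    = λ {u} {v} → link-sym {decode u} {decode v}
    ; irrefl = λ { {u} refl → link-irrefl {decode u} refl }
    ; adj?   = λ u v → link? (decode u) (decode v)
    }

  -- Allows case analysis on the kind of a vertex, although vertices of `G` are plain numbers.
  decode-ind : (P : Fin (k ℕ.* 3) → Set) → (∀ v → P (encode v)) → ∀ u → P u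
  decode-ind P P-encode u = subst P (encode-decode u) (P-encode (decode u))

  encode-adj : ∀ {v w} → Link v w → Adj G (encode v) (encode w)
  encode-adj {v} {w} = subst₂ Link (sym (decode-encode v)) (sym (decode-encode w))

  a b : Fin k → Fin (k ℕ.* 3)
  a i = encode (i , 0F)
  b i = encode (i , 1F)

  noIso : NoIsolatedVertices G
  noIso = decode-ind _ λ where
    (i , 0F) → b i , encode-adj {i , 0F} {i , 1F} refl
    (i , 1F) → a i , encode-adj {i , 1F} {i , 0F} refl
    (i , 2F) → b i , encode-adj {i , 2F} {i , 1F} refl

  -- Used twice: with `⊤` for the connectedness of `G`, and with the set of all `a i` and `b i` for
  -- the bound on `γ꜀`. Each vertex of `S` walks down its path to the clique, where one edge joins
  -- any two distinct `a i`.
  module _ {S : Subset (k ℕ.* 3)} (a∈S : ∀ i → a i ∈ S) (b∈S : ∀ i → b i ∈ S) where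

    b→a : ∀ i → AdjWithin G S (b i) (a i)
    b→a i = b∈S i , a∈S i , encode-adj {i , 1F} {i , 0F} refl

    walkTo-a : ∀ u → u ∈ S → ∃ λ i → Star (AdjWithin G S) u (a i)
    walkTo-a = decode-ind _ λ where
      (i , 0F) _   → i , ε
      (i , 1F) _   → i , b→a i ◅ ε
      (i , 2F) c∈S → i , (c∈S , b∈S i , encode-adj {i , 2F} {i , 1F} refl) ◅ b→a i ◅ ε

    a⇝a : ∀ i j → Star (AdjWithin G S) (a i) (a j)
    a⇝a i j with i ≟ j
    ... | yes refl = ε
    ... | no  i≢j  = (a∈S i , a∈S j , encode-adj {i , 0F} {j , 0F} i≢j) ◅ ε

    inducesConnected : InducesConnected G S
    inducesConnected = (a zero , a∈S zero) , λ u v u∈S v∈S →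
      let i , p = walkTo-a u u∈S
          j , q = walkTo-a v v∈S
      in p ◅◅ a⇝a i j ◅◅ reverse
           (λ {x} {y} (x∈S , y∈S , xy) →
              y∈S , x∈S , Graph.sym G {x} {y} xy) q

  conn : Connected G
  conn = a zero , λ u v → gmap id (proj₂ ∘ proj₂)
    (proj₂ (inducesConnected {⊤} (λ _ → ∈⊤) (λ _ → ∈⊤)) u v ∈⊤ ∈⊤)

  b∈image : ∀ i → b i ∈ image b ⊤
  b∈image i = ∈-image b {x = i} ∈⊤

  dominatedBy-b : ∀ {S} → (∀ i → b i ∈ S) → Dominating G S
  dominatedBy-b b∈S = decode-ind _ λ where
    (i , 0F) _   → b i , b∈S i , encode-adj {i , 0F} {i , 1F} refl
    (i , 1F) b∉S → contradiction (b∈S i) b∉S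
    (i , 2F) _   → b i , b∈S i , encode-adj {i , 2F} {i , 1F} refl

  ∣image⊤∣≤k : ∀ (f : Fin k → Fin (k ℕ.* 3)) → ∣ image f ⊤ ∣ ℕ.≤ k
  ∣image⊤∣≤k f = subst (∣ image f ⊤ ∣ ℕ.≤_) (∣⊤∣≡n k) (∣image∣≤ f ⊤)

  γ≤k : γ G ℕ.≤ k
  γ≤k = ℕ.≤-trans
    (proj₂ (γ-isMinimum G) (image b ⊤) (dominatedBy-b b∈image)) (∣image⊤∣≤k b)

  γ꜀≤k+k : γ꜀ G conn ℕ.≤ k ℕ.+ k
  γ꜀≤k+k = begin
    γ꜀ G conn                            ≤⟨ proj₂ (γ꜀-isMinimum G conn) S connDom ⟩
    ∣ S ∣                                ≤⟨ ∣p∪q∣≤∣p∣+∣q∣ (image a ⊤) (image b ⊤) ⟩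
    ∣ image a ⊤ ∣ ℕ.+ ∣ image b ⊤ ∣      ≤⟨ ℕ.+-mono-≤ (∣image⊤∣≤k a) (∣image⊤∣≤k b) ⟩
    k ℕ.+ k                              ∎
    where
    open ℕ.≤-Reasoning
    S = image a ⊤ ∪ image b ⊤

    a∈S : ∀ i → a i ∈ S
    a∈S i = p⊆p∪q (image b ⊤) (∈-image a {x = i} ∈⊤)

    b∈S : ∀ i → b i ∈ S
    b∈S i = q⊆p∪q (image a ⊤) (image b ⊤) (b∈image i)

    connDom : ConnectedDominating G S
    connDom = dominatedBy-b b∈S , inducesConnected a∈S b∈S

  -- The classes {aᵢ, cᵢ} and {bᵢ} are the neighbourhoods of bᵢ and cᵢ, so a
  -- total dominating set meets all 2k of them.
  class : V → Fin k × Fin 2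
  class (i , 0F) = i , 0F
  class (i , 1F) = i , 1F
  class (i , 2F) = i , 0F

  -- The shift `suc` sends 0F to the label of `b` and 1F to that of `c`, the vertices whose
  -- neighbourhoods are the two classes at `i`.
  link⇒class : ∀ {i} l {w} → Link (i , suc l) w → class w ≡ (i , l)
  link⇒class 0F {_ , 0F} refl = refl
  link⇒class 0F {_ , 2F} refl = refl
  link⇒class 1F {_ , 1F} refl = refl

  -- Numbering the classes turns the count into surjectivity: `π` maps `T` onto all `k * 2` of them,
  -- and an image is no larger than its source.
  k*2≤∣totalDominating∣ : ∀ T → TotalDominating G T → k ℕ.* 2 ℕ.≤ ∣ T ∣
  k*2≤∣totalDominating∣ T total = begin
    k ℕ.* 2            ≡⟨ ∣⊤∣≡n (k ℕ.* 2) ⟨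
    ∣ ⊤ {k ℕ.* 2} ∣    ≤⟨ p⊆q⇒∣p∣≤∣q∣ {p = ⊤} (λ {x} _ → hit x) ⟩
    ∣ image π T ∣      ≤⟨ ∣image∣≤ π T ⟩
    ∣ T ∣              ∎
    where
    open ℕ.≤-Reasoning
    π : Fin (k ℕ.* 3) → Fin (k ℕ.* 2)
    π = uncurry combine ∘ class ∘ decode

    hit : ∀ x → x ∈ image π T
    hit x =
      let i , l = remQuot {k} 2 x
          -- The vertex chosen here has class `x` as its neighbourhood, so its neighbour `u` in `T`
          -- lies in that class.
          u , u∈T , adj = total (encode (i , suc l))
          link = subst (λ v → Link v (decode u)) (decode-encode (i , suc l)) adj
          πu≡x = trans (cong (uncurry combine) (link⇒class l link)) (combine-remQuot {k} 2 x)
      in subst (_∈ image π T) πu≡x (∈-image π u∈T)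

  k*2≤γₜ : k ℕ.* 2 ℕ.≤ γₜ G noIso
  k*2≤γₜ = let T , total , ∣T∣≡γₜ = proj₁ (γₜ-isMinimum G noIso) in
    subst (k ℕ.* 2 ℕ.≤_) ∣T∣≡γₜ (k*2≤∣totalDominating∣ T total)

  -- The bounds `k` and `2k` make the numerator at most `6k`, exactly three times the lower bound on
  -- `γₜ`; the general upper bound then turns this into equality.
  ⌈2[γ+γ꜀]/3⌉≤γₜ : ceiling (+ (2 ℕ.* (γ G ℕ.+ γ꜀ G conn)) / 3) ≤ + γₜ G noIso
  ⌈2[γ+γ꜀]/3⌉≤γₜ = ceiling-≤ 3 (begin
    2 ℕ.* (γ G ℕ.+ γ꜀ G conn)   ≤⟨ ℕ.*-monoʳ-≤ 2 (ℕ.+-mono-≤ γ≤k γ꜀≤k+k) ⟩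
    2 ℕ.* (k ℕ.+ (k ℕ.+ k))     ≡⟨ regroup k ⟩
    k ℕ.* 2 ℕ.* 3               ≤⟨ ℕ.*-monoˡ-≤ 3 k*2≤γₜ ⟩
    γₜ G noIso ℕ.* 3            ∎)
    where
    open ℕ.≤-Reasoning
    regroup : ∀ k → 2 ℕ.* (k ℕ.+ (k ℕ.+ k)) ≡ k ℕ.* 2 ℕ.* 3
    regroup = solve-∀

  -- Ensures that tightness occurs at arbitrarily large values of `γₜ`, not only in one small graph.
  m≤γₜ : m ℕ.≤ γₜ G noIso
  m≤γₜ = ℕ.≤-trans (ℕ.n≤1+n m) (ℕ.≤-trans (ℕ.m≤m*n k 2) k*2≤γₜ)

theorem2p3 : ((G : Graph) (conn : Connected G) (noIso : NoIsolatedVertices G) →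
    + γₜ G noIso ≤ ceiling (+ (2 ℕ.* (γ G ℕ.+ γ꜀ G conn)) / 3))
    ×
    ((N : ℕ) →
    Σ Graph λ G → Σ (Connected G) λ conn → Σ (NoIsolatedVertices G) λ noIso →
    N ℕ.≤ γₜ G noIso
    × + γₜ G noIso ≡ ceiling (+ (2 ℕ.* (γ G ℕ.+ γ꜀ G conn)) / 3))
theorem2p3 =
  (λ G conn noIso → γₜ≤⌈2[γ+γ꜀]/3⌉ G noIso conn) ,
  λ N → let open Extremal N in
    G , conn , noIso , m≤γₜ ,
    ℤ.≤-antisym (γₜ≤⌈2[γ+γ꜀]/3⌉ G noIso conn) ⌈2[γ+γ꜀]/3⌉≤γₜ
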